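{- Let $U$ be a finite totally ordered set. There is a bijection between the set of composition matrices on $U$ and the set of ballot matrices in $\mathrm{BalMat}[U]$ fixed under $\eta$. As a result, calling two ballot matrices $A,B\in\mathrm{BalMat}[U]$ equivalent if $P(A)=P(B)$, every equivalence class contains exactly one ballot matrix fixed under $\eta$.
   Context: Ballots. A ballot on a finite set $V$ is a sequence $B_1B_2\cdots B_k$ ($k\ge 0$) of pairwise disjoint non-empty sets (blocks) with union $V$ (its underlying set); the empty ballot is the one with $k=0$, $V=\emptyset$. Ballot matrices. Let $U$ be a finite totally ordered set. A ballot matrix on $U$ is, for some $m\ge 0$, an upper triangular $m\times m$ matrix whose entries $(i,j)$, $1\le i\le j\le m$, are (possibly empty) ballots with pairwise disjoint underlying sets whose union is $U$, such that every row contains at least one non-empty ballot. $\mathrm{BalMat}[U]$ is the set of these. An element $x\in U$ is "on row $i$ and column $j$" if it lies in the underlying set of entry $(i,j)$. A column is empty if all its entries are empty ballots. Composition matrices. A composition matrix on $U$ is an upper triangular $m\times m$ matrix (for some $m\geq 0$) whose entries on and above the diagonal are (possibly empty) pairwise disjoint sets with union $U$, such that no row and no column consists only of empty sets. The poset $P(A)$. For $A\in\mathrm{BalMat}[U]$, $P(A)$ is the poset on $U$ in which, for $x$ in entry $(i,j)$ and $y$ in entry $(i',j')$, $x<y$ if and only if $j<i'$. (It is an interval order.) Ballot involution. For a ballot $B_1\cdots B_k$ on a totally ordered finite set $V$, let $x=\min V$ and $x\in B_i$. If $|B_i|\ge2$, delete $x$ from $B_i$ and insert a new block $\{x\}$ immediately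 to the right of $B_i$. If $B_i=\{x\}$ and $i>1$, delete this block and add $x$ to $B_{i-1}$. If $B_1=\{x\}$, keep $B_1$ and apply the procedure recursively to $B_2\cdots B_k$ on $V\setminus\{x\}$. The empty ballot is fixed. The map $\psi$ on $\mathrm{BalMat}[U]$. Order the entries of a matrix lexicographically by position $(i,j)$, and apply the ballot involution to the first entry not fixed by it; if all entries are fixed, $\psi(A)=A$. Thus $\psi(A)=A$ iff every entry has the form $\{a_1\}\{a_2\}\cdots\{a_r\}$ with $a_1<\dots<a_r$. The map $\varphi$ on the fixed points of $\psi$. Let $\psi(A)=A$. An element $x$ on row $i$ and column $j$ is a pivot of $A$ if either (a) row $i$ contains at least two elements of $U$ and $x$ is the smallest element on row $i$; or (b) column $i$ is empty, $\{x\}$ is the only non-empty ballot on row $i$, and $x$ is smaller than the minimum element of row $i+1$. If $A$ has no pivots, $\varphi(A)=A$. Otherwise let $x$ be the smallest pivot, in entry $(i,j)$. In case (a), remove $x$ from row $i$, make a new row immediately above row $i$ whose only non-empty entry is $\{x\}$ in column $j$, and then insert a new empty column at position $i$, pushing the existing columns $i,i+1,\dots$ (including the one containing $x$) one step to the right. In case (b), remove column $i$ and merge row $i$ into row $i+1$ by inserting the block $\{x\}$ at the front of the ballot in position $(i+1,j)$. The map $\eta$. $\eta(A)=\varphi(A)$ if $\psi(A)=A$, and $\eta(A)=\psi(A)$ if $\psi(A)\ne A$. -}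

module Defs where

open import Level using (Level; _⊔_)
open import Data.Bool.Base using (if_then_else_)
open import Data.Fin.Base as Fin using (Fin; toℕ; inject₁)
open import Data.Fin.Properties as Fin using (any?; all?)
open import Data.List.Base as List using (List; []; _∷_; concat; filter; foldr; head; length)
open import Data.List.Membership.DecPropositional using () renaming (_∈?_ to mem?)
import Data.List.Membership.Propositional as List∈
import Data.List.Properties as List
open import Data.List.Relation.Unary.All as All using (All; []; _∷_)
open import Data.List.Relation.Unary.AllPairs as AllPairs using (AllPairs; []; _∷_)
import Data.List.Relation.Unary.AllPairs.Properties as AllPairs
open import Data.List.Relation.Unary.Any using (Any)
import Data.List.Relation.Unary.Any as Any
open import Data.Maybe.Base as Maybe using (Maybe; just; nothing; fromMaybe)
import Data.Maybe.Properties as Maybe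
import Data.Maybe.Relation.Unary.Any as MaybeAny
open import Data.Nat.Base using (ℕ; suc; _≤_)
import Data.Nat.Properties as ℕ
open import Data.Product.Base using (Σ; ∃; ∃₂; _×_; _,_; proj₁; proj₂)
open import Data.Sum.Base using (_⊎_; inj₁; inj₂)
open import Data.Vec.Base as Vec using (Vec; []; _∷_; lookup; toList; updateAt; insertAt; removeAt; replicate; _[_]≔_)
import Data.Vec.Properties as Vec
open import Relation.Binary.Bundles using (Setoid)
open import Relation.Binary.Core using (Rel; _⇔_)
open import Relation.Binary.Definitions using (DecidableEquality; tri<; tri≈; tri>)
open import Relation.Binary.PropositionalEquality using (_≡_; _≢_; refl; cong; setoid)
import Relation.Binary.Construct.On as On
open import Relation.Binary.Structures using (IsStrictTotalOrder)
open import Relation.Nullary using (Dec; yes; no; ¬_; does; ¬?; map′; _×-dec_; _⊎-dec_; _→-dec_)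

private
  variable
    c : Level
    A : Set c
    m n : ℕ

SquareMatrix : Set c → ℕ → Set c
SquareMatrix A m = Vec (Vec A m) m

infix 9 _⟨_,_⟩

_⟨_,_⟩ : SquareMatrix A m → Fin m → Fin m → A
M ⟨ i , j ⟩ = lookup (lookup M i) j

updateFirst : (A → Maybe A) → Vec A n → Maybe (Vec A n)
updateFirst f []       = nothing
updateFirst f (x ∷ xs) with f x
... | just y  = just (y ∷ xs)
... | nothing = Maybe.map (x ∷_) (updateFirst f xs)

module BallotMatrices
  {a ℓ : Level} {U : Set a} {_<_ : Rel U ℓ}
  (isStrictTotalOrder : IsStrictTotalOrder _≡_ _<_)
  where

  open IsStrictTotalOrder isStrictTotalOrder using (compare; _≟_; _<?_; trans)

  -- A subset is its increasing enumeration.  As the sortedness proof is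
  -- irrelevant, propositional equality is extensional equality of sets.
  record Subset : Set (a ⊔ ℓ) where
    constructor mkSubset
    field
      elements    : List U
      .increasing : AllPairs _<_ elements

  open Subset public

  infix 4 _∈_ _∈?_ _≟ˢ_

  _∈_ : U → Subset → Set a
  x ∈ S = x List∈.∈ elements S

  _∈?_ : ∀ x S → Dec (x ∈ S)
  x ∈? S = mem? _≟_ x (elements S)

  _≟ˢ_ : DecidableEquality Subset
  S ≟ˢ T = map′ (λ { refl → refl }) (cong elements)
                (List.≡-dec _≟_ (elements S) (elements T))

  ∅ : Subset
  ∅ = mkSubset [] []

  ⁅_⁆ : U → Subset
  ⁅ x ⁆ = mkSubset (x ∷ []) ([] ∷ [])

  ∣_∣ : Subset → ℕ
  ∣ S ∣ = length (elements S)

  -- The enumeration is increasing, so its head is the minimum.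
  min : Subset → Maybe U
  min S = head (elements S)

  insertList : U → List U → List U
  insertList x []       = x ∷ []
  insertList x (y ∷ ys) with compare x y
  ... | tri< _ _ _ = x ∷ y ∷ ys
  ... | tri≈ _ _ _ = y ∷ ys
  ... | tri> _ _ _ = y ∷ insertList x ys

  insertList-All : ∀ {p} {P : U → Set p} {x ys} →
                   P x → All P ys → All P (insertList x ys)
  insertList-All px []         = px ∷ []
  insertList-All {x = x} {ys = y ∷ _} px (py ∷ pys) with compare x y
  ... | tri< _ _ _ = px ∷ py ∷ pys
  ... | tri≈ _ _ _ = py ∷ pys
  ... | tri> _ _ _ = py ∷ insertList-All px pys

  insertList-increasing : ∀ {x ys} → AllPairs _<_ ys → AllPairs _<_ (insertList x ys)
  insertList-increasing []           = [] ∷ []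
  insertList-increasing {x} {y ∷ _} (y<ys ∷ ys↗) with compare x y
  ... | tri< x<y _ _ = (x<y ∷ All.map (trans x<y) y<ys) ∷ y<ys ∷ ys↗
  ... | tri≈ _ _ _   = y<ys ∷ ys↗
  ... | tri> _ _ y<x = insertList-All y<x y<ys ∷ insertList-increasing ys↗

  insert : U → Subset → Subset
  insert x (mkSubset ys ys↗) = mkSubset (insertList x ys) (insertList-increasing ys↗)

  delete : U → Subset → Subset
  delete x (mkSubset ys ys↗) =
    mkSubset (filter (λ y → ¬? (y ≟ x)) ys) (AllPairs.filter⁺ (λ y → ¬? (y ≟ x)) ys↗)

  ⋃ : List Subset → Subset
  ⋃ Ss = foldr insert ∅ (List.concatMap elements Ss)

  Disjoint : Subset → Subset → Set a
  Disjoint S T = ∀ x → ¬ (x ∈ S × x ∈ T)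

  Blocks : Set (a ⊔ ℓ)
  Blocks = List Subset

  infix 4 _∈ᵇ_ _∈ᵇ?_ _≟ᵇ_

  -- Membership in the underlying set of a ballot.
  _∈ᵇ_ : U → Blocks → Set (a ⊔ ℓ)
  x ∈ᵇ Bs = Any (x ∈_) Bs

  _∈ᵇ?_ : ∀ x Bs → Dec (x ∈ᵇ Bs)
  x ∈ᵇ? Bs = Any.any? (x ∈?_) Bs

  _≟ᵇ_ : DecidableEquality Blocks
  _≟ᵇ_ = List.≡-dec _≟ˢ_

  record IsBallot (Bs : Blocks) : Set (a ⊔ ℓ) where
    field
      nonEmpty : All (_≢ ∅) Bs
      disjoint : AllPairs Disjoint Bs

  -- The action on the ballot B ∷ Bs when its minimum is x and B ≢ ⁅ x ⁆.
  -- Recursive calls preserve B ≢ ⁅ x ⁆, so x ∈ B entails that B has at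
  -- least two elements.
  splitOrMerge : U → Subset → Blocks → Blocks
  splitOrMerge x B [] =
    if does (x ∈? B) then delete x B ∷ ⁅ x ⁆ ∷ []
    else B ∷ []
  splitOrMerge x B (C ∷ Bs) =
    if does (x ∈? B) then delete x B ∷ ⁅ x ⁆ ∷ C ∷ Bs
    else if does (C ≟ˢ ⁅ x ⁆) then insert x B ∷ Bs
    else B ∷ splitOrMerge x C Bs

  ballotInvolution : Blocks → Blocks
  ballotInvolution []       = []
  ballotInvolution (B ∷ Bs) with min (⋃ (B ∷ Bs))
  ... | nothing = B ∷ Bs
  ... | just x with B ≟ˢ ⁅ x ⁆
  ...   | yes _ = B ∷ ballotInvolution Bs
  ...   | no  _ = splitOrMerge x B Bs

  record IsBallotMatrix (M : SquareMatrix Blocks m) : Set (a ⊔ ℓ) where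
    field
      upperTriangular : ∀ i j → j Fin.< i → M ⟨ i , j ⟩ ≡ []
      ballots         : ∀ i j → IsBallot (M ⟨ i , j ⟩)
      disjoint        : ∀ i j i′ j′ → (i , j) ≢ (i′ , j′) →
                        ∀ x → ¬ (x ∈ᵇ M ⟨ i , j ⟩ × x ∈ᵇ M ⟨ i′ , j′ ⟩)
      covers          : ∀ x → ∃₂ λ i j → x ∈ᵇ M ⟨ i , j ⟩
      nonEmptyRow     : ∀ i → ∃ λ j → M ⟨ i , j ⟩ ≢ []

  record BalMat : Set (a ⊔ ℓ) where
    field
      size           : ℕ
      entries        : SquareMatrix Blocks size
      isBallotMatrix : IsBallotMatrix entries

    matrix : Σ ℕ (SquareMatrix Blocks)
    matrix = size , entries

  record IsCompositionMatrix (M : SquareMatrix Subset m) : Set (a ⊔ ℓ) where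
    field
      upperTriangular : ∀ i j → j Fin.< i → M ⟨ i , j ⟩ ≡ ∅
      disjoint        : ∀ i j i′ j′ → (i , j) ≢ (i′ , j′) →
                        Disjoint (M ⟨ i , j ⟩) (M ⟨ i′ , j′ ⟩)
      covers          : ∀ x → ∃₂ λ i j → x ∈ M ⟨ i , j ⟩
      nonEmptyRow     : ∀ i → ∃ λ j → M ⟨ i , j ⟩ ≢ ∅
      nonEmptyColumn  : ∀ j → ∃ λ i → M ⟨ i , j ⟩ ≢ ∅

  record CompMat : Set (a ⊔ ℓ) where
    field
      size                : ℕ
      entries             : SquareMatrix Subset size
      isCompositionMatrix : IsCompositionMatrix entries

    matrix : Σ ℕ (SquareMatrix Subset)
    matrix = size , entries

  -- Matrices are equal when they have the same size and the same entries;
  -- the validity proofs are ignored.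
  BalMat-setoid : Setoid (a ⊔ ℓ) (a ⊔ ℓ)
  BalMat-setoid = On.setoid (setoid (Σ ℕ (SquareMatrix Blocks))) BalMat.matrix

  CompMat-setoid : Setoid (a ⊔ ℓ) (a ⊔ ℓ)
  CompMat-setoid = On.setoid (setoid (Σ ℕ (SquareMatrix Subset))) CompMat.matrix

  open Setoid BalMat-setoid public using () renaming (_≈_ to _≈ᴹ_)

  -- The order relation of the poset P(A).
  P : BalMat → Rel U (a ⊔ ℓ)
  P A x y = ∃₂ λ i j → ∃₂ λ i′ j′ →
    x ∈ᵇ entries ⟨ i , j ⟩ × y ∈ᵇ entries ⟨ i′ , j′ ⟩ × j Fin.< i′
    where open BalMat A

  Equivalent : Rel BalMat (a ⊔ ℓ)
  Equivalent A B = P A ⇔ P B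

  -- ψ, φ and η are total on square arrays of block lists; only their values
  -- on ballot matrices (for φ: on those fixed by ψ) matter.

  -- Row by row, left to right is the lexicographic order of positions; the
  -- entries below the diagonal are empty ballots, hence fixed.
  ψ : SquareMatrix Blocks m → SquareMatrix Blocks m
  ψ M = fromMaybe M (updateFirst (updateFirst move) M)
    where
    move : Blocks → Maybe Blocks
    move Bs with ballotInvolution Bs ≟ᵇ Bs
    ... | yes _ = nothing
    ... | no  _ = just (ballotInvolution Bs)

  rowSet : SquareMatrix Blocks m → Fin m → Subset
  rowSet M i = ⋃ (concat (toList (lookup M i)))

  underlyingSet : SquareMatrix Blocks m → Subset
  underlyingSet M = ⋃ (concat (toList (Vec.concat M)))

  EmptyColumn : SquareMatrix Blocks m → Fin m → Set (a ⊔ ℓ)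
  EmptyColumn M j = ∀ i → M ⟨ i , j ⟩ ≡ []

  PivotA : SquareMatrix Blocks m → U → (i j : Fin m) → Set (a ⊔ ℓ)
  PivotA M x i j =
    x ∈ᵇ M ⟨ i , j ⟩ × 2 ≤ ∣ rowSet M i ∣ × min (rowSet M i) ≡ just x

  -- i⁺ is the row following i.
  PivotB : SquareMatrix Blocks m → U → (i j i⁺ : Fin m) → Set (a ⊔ ℓ)
  PivotB M x i j i⁺ =
    toℕ i⁺ ≡ suc (toℕ i) ×
    EmptyColumn M i ×
    M ⟨ i , j ⟩ ≡ ⁅ x ⁆ ∷ [] × (∀ j′ → j′ ≢ j → M ⟨ i , j′ ⟩ ≡ []) ×
    MaybeAny.Any (x <_) (min (rowSet M i⁺))

  Pivot : SquareMatrix Blocks m → U → Set (a ⊔ ℓ)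
  Pivot M x = (∃₂ λ i j → PivotA M x i j) ⊎ (∃₂ λ i j → ∃ λ i⁺ → PivotB M x i j i⁺)

  pivot? : ∀ (M : SquareMatrix Blocks m) x → Dec (Pivot M x)
  pivot? M x =
    any? (λ i → any? λ j →
      x ∈ᵇ? M ⟨ i , j ⟩ ×-dec 2 ℕ.≤? ∣ rowSet M i ∣ ×-dec
      Maybe.≡-dec _≟_ (min (rowSet M i)) (just x))
    ⊎-dec
    any? (λ i → any? λ j → any? λ i⁺ →
      toℕ i⁺ ℕ.≟ suc (toℕ i) ×-dec
      all? (λ k → M ⟨ k , i ⟩ ≟ᵇ []) ×-dec
      M ⟨ i , j ⟩ ≟ᵇ ⁅ x ⁆ ∷ [] ×-dec
      all? (λ j′ → ¬? (j′ Fin.≟ j) →-dec M ⟨ i , j′ ⟩ ≟ᵇ []) ×-dec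
      MaybeAny.dec (x <?_) (min (rowSet M i⁺)))

  -- Searching an increasing list finds the smallest pivot in it.
  firstPivot : (M : SquareMatrix Blocks m) → List U → Maybe (∃ (Pivot M))
  firstPivot M []       = nothing
  firstPivot M (x ∷ xs) with pivot? M x
  ... | yes p = just (x , p)
  ... | no  _ = firstPivot M xs

  -- As M is fixed by ψ, the element x forms a block ⁅ x ⁆ of its own.
  moveA : SquareMatrix Blocks m → U → (i j : Fin m) → SquareMatrix Blocks (suc m)
  moveA {m} M x i j =
    Vec.map (λ row → insertAt row (inject₁ i) []) (insertAt removed (inject₁ i) newRow)
    where
    removed : SquareMatrix Blocks m
    removed = updateAt M i (λ row → updateAt row j (filter (λ B → ¬? (B ≟ˢ ⁅ x ⁆))))

    newRow : Vec Blocks m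
    newRow = replicate m [] [ j ]≔ (⁅ x ⁆ ∷ [])

  -- Row i has no element besides x, so merging it into row i⁺ amounts to
  -- moving x.  Row i⁺ is still indexed by the columns of M here: column i is
  -- removed afterwards.
  moveB : SquareMatrix Blocks (suc m) → U → (i j i⁺ : Fin (suc m)) → SquareMatrix Blocks m
  moveB {m} M x i j i⁺ = Vec.map (λ row → removeAt row i) (removeAt merged i)
    where
    merged : SquareMatrix Blocks (suc m)
    merged = updateAt M i⁺ (λ row → updateAt row j (⁅ x ⁆ ∷_))

  φ : SquareMatrix Blocks m → Σ ℕ (SquareMatrix Blocks)
  φ {m}     M with firstPivot M (elements (underlyingSet M))
  φ {m}     M | nothing                          = m , M
  φ {m}     M | just (x , inj₁ (i , j , _))      = suc m , moveA M x i j
  φ {suc m} M | just (x , inj₂ (i , j , i⁺ , _)) = m , moveB M x i j i⁺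

  η : Σ ℕ (SquareMatrix Blocks) → Σ ℕ (SquareMatrix Blocks)
  η (m , M) with Vec.≡-dec (Vec.≡-dec _≟ᵇ_) (ψ M) M
  ... | yes _ = φ M
  ... | no  _ = m , ψ M

  Fixed : BalMat → Set (a ⊔ ℓ)
  Fixed A = η (BalMat.matrix A) ≡ BalMat.matrix A

  FixedBalMat-setoid : Setoid (a ⊔ ℓ) (a ⊔ ℓ)
  FixedBalMat-setoid = On.setoid {B = ∃ Fixed} BalMat-setoid proj₁

-- A ballot matrix is fixed by η exactly when each row holds a single element and
-- every empty column i < m forces a descent: the element of row i + 1 is smaller
-- than that of row i.  Composition matrices and fixed matrices both turn out to be
-- determined by their interval orders, and each is built from the other without
-- changing that order.  A matrix is handled through the functions sending an
-- element to its row and column.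
--
-- Compression: if column i is empty, rows i and i + 1 can be merged; repeating this
-- makes all columns non-empty.  Expansion: each row of a composition matrix is
-- split into singleton rows in decreasing order, and a column j becomes the column
-- whose index is the last row of the group coming from row j.
module Submission where

open import Defs
open import Level using (Level; _⊔_)
open import Data.Fin.Base as Fin using (Fin; zero; suc; toℕ; fromℕ; fromℕ<; inject₁; pinch; lower₁)
import Data.Fin.Properties as Fin
open import Data.List.Base as List using (List; []; _∷_; filter; length)
import Data.List.Membership.Propositional as List∈
import Data.List.Membership.Propositional.Properties as List∈
import Data.List.Properties as List
open import Data.List.Relation.Unary.All as All using (All; []; _∷_)
open import Data.List.Relation.Unary.AllPairs as AllPairs using (AllPairs; []; _∷_)
import Data.List.Relation.Unary.AllPairs.Properties as AllPairs
open import Data.List.Relation.Unary.Any using (Any; here; there)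
import Data.List.Relation.Unary.Any.Properties as Any
open import Data.Maybe.Base using (Maybe; just; nothing; fromMaybe)
import Data.Maybe.Relation.Unary.Any as MaybeAny
open import Data.Nat.Base as ℕ using (ℕ; zero; suc; z≤n; s≤s)
import Data.Nat.Properties as ℕ
open import Data.Product using (∃; ∃₂; ∃!; _×_; _,_; proj₁; proj₂)
open import Data.Product.Properties using (,-injectiveʳ-UIP)
open import Data.Product.Relation.Binary.Lex.Strict using (×-Lex; ×-isStrictTotalOrder)
open import Data.Sum.Base using (_⊎_; inj₁; inj₂)
open import Data.Vec.Base as Vec using (Vec; []; _∷_; lookup; tabulate; toList)
import Data.Vec.Properties as Vec
open import Data.Vec.Relation.Unary.Any as VecAny using (here; there)
import Data.Vec.Relation.Unary.Any.Properties as VecAny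
open import Function.Base using (case_of_; flip; _∘_; _on_)
open import Function.Bundles using (Bijection; Inverse; _↔_)
import Relation.Binary.Construct.Flip.EqAndOrd as Flip
import Relation.Binary.Construct.On as On
open import Relation.Binary.Core using (Rel)
open import Relation.Binary.Definitions using (tri<; tri≈; tri>)
open import Relation.Binary.PropositionalEquality
open import Relation.Binary.Structures using (IsStrictTotalOrder)
open import Relation.Nullary using (Dec; yes; no; ¬_; contradiction; map′; recompute; _×-dec_)
open import Relation.Unary using (Pred; Decidable; _⊆_)

private
  variable
    a ℓ₁ ℓ₂ : Level
    A : Set a
    m m′ n : ℕ

-- Finite functions, `pinch` and lengths of filtered lists.

injective⇒surjective : (f : Fin n → Fin n) → (∀ {i j} → f i ≡ f j → i ≡ j) →
                       ∀ i → ∃ λ j → f j ≡ i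
injective⇒surjective {suc n} f inj i with Fin.any? (λ j → f j Fin.≟ i)
... | yes hit = hit
-- `punchOut` at the missed value `i` would inject `Fin (suc n)` into `Fin n`.
... | no miss = contradiction
  (Fin.injective⇒≤ {f = λ j → Fin.punchOut (i≢f j)} (inj ∘ Fin.punchOut-injective (i≢f _) (i≢f _)))
  ℕ.1+n≰n
  where
  i≢f : ∀ j → i ≢ f j
  i≢f j i≡fj = miss (j , sym i≡fj)

-- The only two indices that `pinch i` identifies are `inject₁ i` and `suc i`, so strictness can
-- fail only when the smaller index is `inject₁ i`.
pinch-strict : ∀ (i : Fin n) {j k} → j ≢ inject₁ i → j Fin.< k → pinch i j Fin.< pinch i k
pinch-strict zero    {zero}  {suc k} j≢i _          = contradiction refl j≢i
pinch-strict zero    {suc j} {suc k} _   (s≤s j<k)  = j<k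
pinch-strict (suc i) {zero}  {suc k} _   _          = s≤s z≤n
pinch-strict (suc i) {suc j} {suc k} j≢i (s≤s j<k)  =
  s≤s (pinch-strict i (j≢i ∘ cong suc) j<k)

module _ {P : Pred A ℓ₁} {Q : Pred A ℓ₂} (P? : Decidable P) (Q? : Decidable Q) (P⊆Q : P ⊆ Q) where

  length-filter-mono : ∀ xs → length (filter P? xs) ℕ.≤ length (filter Q? xs)
  length-filter-mono []       = z≤n
  length-filter-mono (x ∷ xs) with P? x | Q? x
  ... | yes _  | yes _  = s≤s (length-filter-mono xs)
  ... | yes px | no ¬qx = contradiction (P⊆Q px) ¬qx
  ... | no _   | yes _  = ℕ.m≤n⇒m≤1+n (length-filter-mono xs)
  ... | no _   | no _   = length-filter-mono xs

  length-filter-strict : ∀ {x xs} → x List∈.∈ xs → ¬ P x → Q x →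
                         length (filter P? xs) ℕ.< length (filter Q? xs)
  length-filter-strict {x} {_ ∷ xs} (here refl) ¬px qx with P? x | Q? x
  ... | yes px | _      = contradiction px ¬px
  ... | no _   | yes _  = s≤s (length-filter-mono xs)
  ... | no _   | no ¬qx = contradiction qx ¬qx
  length-filter-strict {xs = y ∷ xs} (there x∈xs) ¬px qx with P? y | Q? y
  ... | yes _  | yes _  = s≤s (length-filter-strict x∈xs ¬px qx)
  ... | yes py | no ¬qy = contradiction (P⊆Q py) ¬qy
  ... | no _   | yes _  = ℕ.m≤n⇒m≤1+n (length-filter-strict x∈xs ¬px qx)
  ... | no _   | no _   = length-filter-strict x∈xs ¬px qx

-- Comparison of surjective labellings.

module _ {a} {U : Set a} where

  module _ (f : U → Fin m) (g : U → Fin m′)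
           (f-surjective : ∀ i → ∃ λ x → f x ≡ i)
           (mono : ∀ {x y} → f x Fin.< f y → g x Fin.< g y) where

    -- Surjectivity of `f` supplies elements with labels 0, 1, ..., `f x`, and `g` increases
    -- strictly along this chain.
    surjective-least : ∀ x → toℕ (f x) ℕ.≤ toℕ (g x)
    surjective-least x = go (toℕ (f x)) x refl
      where
      go : ∀ k x → toℕ (f x) ≡ k → k ℕ.≤ toℕ (g x)
      go zero    x _     = z≤n
      go (suc k) x fx≡1+k with
        f-surjective (fromℕ< (ℕ.<-trans (ℕ.≤-reflexive (sym fx≡1+k)) (Fin.toℕ<n (f x))))
      ... | y , fy≡k = ℕ.≤-<-trans (go k y toℕfy≡k)
                         (mono (subst₂ ℕ._<_ (sym toℕfy≡k) (sym fx≡1+k) ℕ.≤-refl))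
        where
        toℕfy≡k : toℕ (f y) ≡ k
        toℕfy≡k = trans (cong toℕ fy≡k) (Fin.toℕ-fromℕ< _)

  surjective-size : (f : U → Fin m) (g : U → Fin m′) →
                    (∀ i → ∃ λ x → f x ≡ i) →
                    (∀ {x y} → f x Fin.< f y → g x Fin.< g y) → m ℕ.≤ m′
  surjective-size {zero}  f g f-surj mono = z≤n
  surjective-size {suc m} f g f-surj mono with f-surj (fromℕ m)
  ... | x , fx≡m = ℕ.≤-<-trans
    (subst (ℕ._≤ toℕ (g x)) (trans (cong toℕ fx≡m) (Fin.toℕ-fromℕ m))
      (surjective-least f g f-surj mono x))
    (Fin.toℕ<n (g x))

-- Search and ranks in a finite set.

module Finite {a} {U : Set a} {n} (finite : Fin n ↔ U) where

  open Inverse finite using (to; from; strictlyInverseˡ)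

  exists? : ∀ {p} {P : Pred U p} → Decidable P → Dec (∃ P)
  exists? {P = P} P? = map′
    (λ (i , pi) → to i , pi)
    (λ (x , px) → from x , subst P (sym (strictlyInverseˡ x)) px)
    (Fin.any? (P? ∘ to))

  enumeration : List U
  enumeration = List.tabulate to

  ∈-enumeration : ∀ x → x List∈.∈ enumeration
  ∈-enumeration x = subst (List∈._∈ enumeration) (strictlyInverseˡ x) (List∈.∈-tabulate⁺ (from x))

  -- The equality `_≈_` is kept apart from `_≡_` because the lexicographic order ranked later
  -- carries componentwise equality of pairs of a row and an element.
  module Rank {ℓ₁ ℓ₂} {_≈_ : Rel U ℓ₁} {_≺_ : Rel U ℓ₂}
              (isStrictTotalOrder : IsStrictTotalOrder _≈_ _≺_)
              (≈⇒≡ : ∀ {x y} → x ≈ y → x ≡ y) where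

    open IsStrictTotalOrder isStrictTotalOrder using (compare; _<?_; irrefl; module Eq)
      renaming (trans to ≺-trans)

    below : U → List U
    below x = filter (_<? x) enumeration

    below-bound : ∀ x → length (below x) ℕ.< n
    below-bound x = subst (length (below x) ℕ.<_) (List.length-tabulate to)
      (List.filter-notAll (_<? x) enumeration
        (List∈.lose (∈-enumeration x) (irrefl Eq.refl)))

    rank : U → Fin n
    rank x = fromℕ< (below-bound x)

    rank-mono : ∀ {x y} → x ≺ y → rank x Fin.< rank y
    rank-mono {x} {y} x≺y =
      subst₂ ℕ._<_ (sym (Fin.toℕ-fromℕ< (below-bound x))) (sym (Fin.toℕ-fromℕ< (below-bound y)))
        (length-filter-strict (_<? x) (_<? y) (λ z≺x → ≺-trans z≺x x≺y)
          (∈-enumeration x) (irrefl Eq.refl) x≺y)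

    rank-cancel : ∀ {x y} → rank x Fin.< rank y → x ≺ y
    rank-cancel {x} {y} rx<ry with compare x y
    ... | tri< x≺y _ _ = x≺y
    ... | tri≈ _ x≈y _ = contradiction rx<ry (ℕ.<-irrefl (cong (toℕ ∘ rank) (≈⇒≡ x≈y)))
    ... | tri> _ _ y≺x = contradiction rx<ry (ℕ.<-asym (rank-mono y≺x))

    rank-injective : ∀ {x y} → rank x ≡ rank y → x ≡ y
    rank-injective {x} {y} rx≡ry with compare x y
    ... | tri< x≺y _ _ = contradiction (rank-mono x≺y) (ℕ.<-irrefl (cong toℕ rx≡ry))
    ... | tri≈ _ x≈y _ = ≈⇒≡ x≈y
    ... | tri> _ _ y≺x = contradiction (rank-mono y≺x) (ℕ.<-irrefl (cong toℕ (sym rx≡ry)))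

    rank-surjective : ∀ i → ∃ λ x → rank x ≡ i
    rank-surjective i with injective⇒surjective (rank ∘ to)
      (λ eq → trans (sym (Inverse.strictlyInverseʳ finite _))
              (trans (cong from (rank-injective eq)) (Inverse.strictlyInverseʳ finite _))) i
    ... | j , eq = to j , eq

-- Vectors and matrices by their entries.

any-lookup : {P : Pred A ℓ₁} (xs : Vec A n) (i : Fin n) → P (lookup xs i) → VecAny.Any P xs
any-lookup (_ ∷ _)  zero    px = here px
any-lookup (_ ∷ xs) (suc i) px = there (any-lookup xs i px)

matrix-ext : (M N : SquareMatrix A m) → (∀ i j → M ⟨ i , j ⟩ ≡ N ⟨ i , j ⟩) → M ≡ N
matrix-ext M N eq = vec-ext M N (λ i → vec-ext (lookup M i) (lookup N i) (eq i))
  where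
  vec-ext : ∀ {c} {C : Set c} {k} (xs ys : Vec C k) → (∀ i → lookup xs i ≡ lookup ys i) → xs ≡ ys
  vec-ext xs ys eq =
    trans (sym (Vec.tabulate∘lookup xs)) (trans (Vec.tabulate-cong eq) (Vec.tabulate∘lookup ys))

fromCells : (Fin m → Fin m → A) → SquareMatrix A m
fromCells f = tabulate (λ i → tabulate (f i))

lookup-fromCells : (f : Fin m → Fin m → A) → ∀ i j → fromCells f ⟨ i , j ⟩ ≡ f i j
lookup-fromCells f i j =
  trans (cong (λ row → lookup row j) (Vec.lookup∘tabulate (λ i → tabulate (f i)) i))
        (Vec.lookup∘tabulate (f i) j)

updateFirst-nothing : (f : A → Maybe A) (xs : Vec A n) →
                      (∀ i → f (lookup xs i) ≡ nothing) → updateFirst f xs ≡ nothing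
updateFirst-nothing f []       _    = refl
updateFirst-nothing f (x ∷ xs) none with f x | none zero
... | nothing | refl rewrite updateFirst-nothing f xs (none ∘ suc) = refl

module Proof {a ℓ : Level} {U : Set a} {_<_ : Rel U ℓ} {n : ℕ}
  (finite : Fin n ↔ U) (isStrictTotalOrder : IsStrictTotalOrder _≡_ _<_) where

  -- Placements and their interval orders.

  open Finite finite
  open IsStrictTotalOrder isStrictTotalOrder using (compare; _≟_; _<?_; irrefl; asym)

  -- Total functions encode that the entries are disjoint and cover `U`; the two laws are upper
  -- triangularity and non-emptiness of the rows. The blocks inside an entry are forgotten, as P(A)
  -- does not depend on them.
  record Placement (m : ℕ) : Set a where
    field
      row col        : U → Fin m
      row≤col        : ∀ x → row x Fin.≤ col x
      row-surjective : ∀ i → ∃ λ x → row x ≡ i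

  open Placement public

  infix 4 _⊑_

  _⊑_ : Placement m → Placement m′ → Set a
  p ⊑ q = ∀ {x y} → col p x Fin.< row p y → col q x Fin.< row q y

  SameOrder : Placement m → Placement m′ → Set a
  SameOrder p q = p ⊑ q × q ⊑ p

  -- Positions are compared through `toℕ` because the two sizes are only propositionally equal.
  Agree : Placement m → Placement m′ → Set a
  Agree {m} {m′} p q =
    m ≡ m′ × (∀ x → toℕ (row p x) ≡ toℕ (row q x)) × (∀ x → toℕ (col p x) ≡ toℕ (col q x))

  ColSurjective : Placement m → Set a
  ColSurjective p = ∀ j → ∃ λ x → col p x ≡ j

  -- The placements of the ballot matrices fixed by η: the two fields exclude
  -- pivots of type (a) and (b) respectively.
  record Rigid (p : Placement m) : Set (a ⊔ ℓ) where
    field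
      row-injective : ∀ {x y} → row p x ≡ row p y → x ≡ y
      descent       : ∀ {x y} → toℕ (row p y) ≡ suc (toℕ (row p x)) →
                      (∀ z → col p z ≢ row p x) → y < x

  open Rigid

  -- Some `z` lies on row `col p x` of `p`. It is not above `x` in `p`, hence not in `q` either, and
  -- so `col q x` is at least `row q z`, which equals `col p x`.
  col-least : (p : Placement m) (q : Placement m′) →
              (∀ x → toℕ (row p x) ≡ toℕ (row q x)) → q ⊑ p →
              ∀ x → toℕ (col p x) ℕ.≤ toℕ (col q x)
  col-least p q rows q⊑p x with row-surjective p (col p x)
  ... | z , rz≡cx = subst (ℕ._≤ toℕ (col q x)) (trans (sym (rows z)) (cong toℕ rz≡cx))
    (ℕ.≮⇒≥ λ cx<rz → ℕ.<-irrefl (cong toℕ (sym rz≡cx)) (q⊑p cx<rz))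

  -- Only the orders of the rows need comparing: surjectivity in both directions equates sizes and
  -- rows, and `col-least` then recovers the columns from the interval order.
  agree : (p : Placement m) (q : Placement m′) → SameOrder p q →
          (∀ {x y} → row p x Fin.< row p y → row q x Fin.< row q y) →
          (∀ {x y} → row q x Fin.< row q y → row p x Fin.< row p y) →
          Agree p q
  agree p q (p⊑q , q⊑p) mono mono⁻¹ =
    ℕ.≤-antisym (surjective-size (row p) (row q) (row-surjective p) mono)
                (surjective-size (row q) (row p) (row-surjective q) mono⁻¹) ,
    rows ,
    λ x → ℕ.≤-antisym (col-least p q rows q⊑p x) (col-least q p (sym ∘ rows) p⊑q x)
    where
    rows : ∀ x → toℕ (row p x) ≡ toℕ (row q x)
    rows x = ℕ.≤-antisym (surjective-least (row p) (row q) (row-surjective p) mono x)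
                         (surjective-least (row q) (row p) (row-surjective q) mono⁻¹ x)

  -- The hypotheses say that `z` is below `y` but not below `x`. Both are statements about the
  -- interval order, so they hold in `q` and place `col q z` between the two rows there.
  separated : (p : Placement m) (q : Placement m′) → SameOrder p q → ∀ {x y z} →
              row p x Fin.≤ col p z → col p z Fin.< row p y → row q x Fin.< row q y
  separated p q (p⊑q , q⊑p) rx≤cz cz<ry =
    ℕ.≤-<-trans (ℕ.≮⇒≥ (λ cz<rx → ℕ.<⇒≱ (q⊑p cz<rx) rx≤cz)) (p⊑q cz<ry)

  colSurjective-row-mono : (p : Placement m) (q : Placement m′) → ColSurjective p → SameOrder p q →
    ∀ {x y} → row p x Fin.< row p y → row q x Fin.< row q y
  colSurjective-row-mono p q surj same {x} rx<ry with surj (row p x)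
  ... | z , cz≡rx = separated p q same (Fin.≤-reflexive (sym cz≡rx))
                      (subst (Fin._< _) (sym cz≡rx) rx<ry)

  sameOrder-sym : (p : Placement m) (q : Placement m′) → SameOrder p q → SameOrder q p
  sameOrder-sym p q (p⊑q , q⊑p) = q⊑p , p⊑q

  -- Each index is both a left and a right endpoint, so every two rows are separated by an element
  -- and the order determines the rows. This is the uniqueness of the canonical interval
  -- representation.
  colSurjective-unique : (p : Placement m) (q : Placement m′) → ColSurjective p → ColSurjective q →
                         SameOrder p q → Agree p q
  colSurjective-unique p q p-surj q-surj same@(p⊑q , q⊑p) = agree p q same
    (colSurjective-row-mono p q p-surj same) (colSurjective-row-mono q p q-surj (q⊑p , p⊑q))

  -- pinch i merges row i + 1 into row i; as column i is empty, no relation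
  -- col x < row y is lost.
  compress : (p : Placement m) →
             ∃₂ λ k (q : Placement k) → ColSurjective q × SameOrder p q
  compress {zero}  p = zero , p , (λ ()) , (λ c<r → c<r) , (λ c<r → c<r)
  compress {suc m} p with Fin.all? (λ j → exists? (λ x → col p x Fin.≟ j))
  ... | yes surj  = suc m , p , surj , (λ c<r → c<r) , (λ c<r → c<r)
  ... | no  ¬surj with Fin.¬∀⟶∃¬ (suc m) _ (λ j → exists? (λ x → col p x Fin.≟ j)) ¬surj
  ...   | j , empty =
    let k , q , surj , merged⊑q , q⊑merged = compress merged in
    k , q , surj , merged⊑q ∘ strict , unstrict ∘ q⊑merged
    where
    -- The last column is never empty, since an element on the last row must lie in it. Hence row
    -- `j` has a following row to be merged with.
    m≢j : m ≢ toℕ j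
    m≢j m≡j with row-surjective p j
    ... | x , rx≡j = empty (x , Fin.toℕ-injective (ℕ.≤-antisym
      (subst (toℕ (col p x) ℕ.≤_) m≡j (ℕ.s≤s⁻¹ (Fin.toℕ<n (col p x))))
      (subst (ℕ._≤ toℕ (col p x)) (cong toℕ rx≡j) (row≤col p x))))

    i : Fin m
    i = lower₁ j m≢j

    merged : Placement m
    merged = record
      { row            = pinch i ∘ row p
      ; col            = pinch i ∘ col p
      ; row≤col        = λ x → Fin.pinch-mono-≤ i (row≤col p x)
      ; row-surjective = λ k →
          let r , pinch-r≡k = Fin.pinch-surjective i k
              x , rx≡r      = row-surjective p r
          in x , pinch-r≡k rx≡r
      }

    strict : p ⊑ merged
    strict {x} = pinch-strict i (λ cx≡i → empty (x , trans cx≡i (Fin.inject₁-lower₁ j m≢j)))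

    unstrict : merged ⊑ p
    unstrict c<r = ℕ.≰⇒> (λ r≤c → ℕ.<⇒≱ c<r (Fin.pinch-mono-≤ i r≤c))


  -- Uniqueness of rigid placements.

  module Lex (p : Placement m) where

    infix 4 _≺_

    -- Within a row larger elements come first, hence `flip _<_`: this is the order in which
    -- expansion lists the elements.
    _≺_ : Rel U ℓ
    _≺_ = ×-Lex _≡_ Fin._<_ (flip _<_) on λ x → row p x , x

    ≺-isStrictTotalOrder : IsStrictTotalOrder _ _≺_
    ≺-isStrictTotalOrder = On.isStrictTotalOrder (λ x → row p x , x)
      (×-isStrictTotalOrder Fin.<-isStrictTotalOrder (Flip.isStrictTotalOrder isStrictTotalOrder))

    open IsStrictTotalOrder ≺-isStrictTotalOrder public using ()
      renaming (trans to ≺-trans; asym to ≺-asym)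

  module _ (p : Placement m) (rigid : Rigid p)
           (q : Placement m′) (surj : ColSurjective q) (same : SameOrder p q) where

    open Lex q

    -- An element in column `row p x` separates the two rows in `q` as well. If that column is
    -- empty, `descent` breaks a tie in `q` the right way, and `y` cannot come on an earlier row of
    -- `q` because rows distinguished by `q` are ordered alike in `p`.
    consecutive-rows : ∀ {x y} → toℕ (row p y) ≡ suc (toℕ (row p x)) → x ≺ y
    consecutive-rows {x} {y} ry≡1+rx with exists? (λ z → col p z Fin.≟ row p x)
    ... | yes (z , cz≡rx) = inj₁ (separated p q same (Fin.≤-reflexive (sym cz≡rx))
      (ℕ.≤-reflexive (trans (cong (suc ∘ toℕ) cz≡rx) (sym ry≡1+rx))))
    ... | no empty with ℕ.<-cmp (toℕ (row q x)) (toℕ (row q y))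
    ...   | tri< rx<ry _ _ = inj₁ rx<ry
    ...   | tri≈ _ rx≡ry _ =
      inj₂ (Fin.toℕ-injective rx≡ry , descent rigid ry≡1+rx (λ z cz≡rx → empty (z , cz≡rx)))
    ...   | tri> _ _ ry<rx = contradiction
      (colSurjective-row-mono q p surj (sameOrder-sym p q same) ry<rx)
      (ℕ.<-asym (ℕ.≤-reflexive (sym ry≡1+rx)))

    rigid⇒≺ : ∀ {x y} → row p x Fin.< row p y → x ≺ y
    rigid⇒≺ {x} {y} = go (toℕ (row p y)) y refl
      where
      go : ∀ k y → toℕ (row p y) ≡ k → toℕ (row p x) ℕ.< k → x ≺ y
      go (suc k) y ry≡1+k rx<1+k with ℕ.m≤n⇒m<n∨m≡n (ℕ.s≤s⁻¹ rx<1+k)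
      ... | inj₂ rx≡k = consecutive-rows (trans ry≡1+k (cong suc (sym rx≡k)))
      -- An element `z` on the row preceding that of `y` reduces the claim to `x` and `z`.
      ... | inj₁ rx<k with
        row-surjective p (fromℕ< (ℕ.<-trans (ℕ.≤-reflexive (sym ry≡1+k)) (Fin.toℕ<n (row p y))))
      ...   | z , rz≡k′ = ≺-trans {x} {z} {y} (go k z rz≡k rx<k)
                            (consecutive-rows (trans ry≡1+k (cong suc (sym rz≡k))))
        where
        rz≡k : toℕ (row p z) ≡ k
        rz≡k = trans (cong toℕ rz≡k′) (Fin.toℕ-fromℕ< _)

    ≺⇒rigid : ∀ {x y} → x ≺ y → row p x Fin.< row p y
    ≺⇒rigid {x} {y} x≺y with Fin.<-cmp (row p x) (row p y)
    ... | tri< rx<ry _ _ = rx<ry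
    ... | tri≈ _ rx≡ry _ with refl ← row-injective rigid rx≡ry = contradiction x≺y (≺-asym {x} {x} x≺y)
    ... | tri> _ _ ry<rx = contradiction x≺y (≺-asym {y} {x} (rigid⇒≺ ry<rx))

  -- Both placements are compared with the compression `c` of `p`, which carries the order of `q`
  -- too. The row order of each is then the order `≺` of `c`.
  rigid-unique : (p : Placement m) (q : Placement m′) → Rigid p → Rigid q →
                 SameOrder p q → Agree p q
  rigid-unique p q p-rigid q-rigid same@(p⊑q , q⊑p) =
    let k , c , surj , p⊑c , c⊑p = compress p
        sameᶜ : SameOrder q c
        sameᶜ = p⊑c ∘ q⊑p , p⊑q ∘ c⊑p
    in agree p q same
      (λ rx<ry → ≺⇒rigid q q-rigid c surj sameᶜ (rigid⇒≺ p p-rigid c surj (p⊑c , c⊑p) rx<ry))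
      (λ rx<ry → ≺⇒rigid p p-rigid c surj (p⊑c , c⊑p) (rigid⇒≺ q q-rigid c surj sameᶜ rx<ry))

  -- Sets as increasing lists.

  open BallotMatrices isStrictTotalOrder

  ∈-insertList⁺ : ∀ {x y} (ys : List U) → x ≡ y ⊎ x List∈.∈ ys → x List∈.∈ insertList y ys
  ∈-insertList⁺ [] (inj₁ refl) = here refl
  ∈-insertList⁺ {x} {y} (z ∷ ys) x∈ with compare y z | x∈
  ... | tri< _ _ _    | inj₁ refl        = here refl
  ... | tri< _ _ _    | inj₂ x∈zs        = there x∈zs
  ... | tri≈ _ refl _ | inj₁ refl        = here refl
  ... | tri≈ _ _ _    | inj₂ x∈zs        = x∈zs
  ... | tri> _ _ _    | inj₁ refl        = there (∈-insertList⁺ ys (inj₁ refl))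
  ... | tri> _ _ _    | inj₂ (here refl) = here refl
  ... | tri> _ _ _    | inj₂ (there x∈)  = there (∈-insertList⁺ ys (inj₂ x∈))

  ∈-insertList⁻ : ∀ {x y} (ys : List U) → x List∈.∈ insertList y ys → x ≡ y ⊎ x List∈.∈ ys
  ∈-insertList⁻ [] (here x≡y) = inj₁ x≡y
  ∈-insertList⁻ {x} {y} (z ∷ ys) x∈ with compare y z | x∈
  ... | tri< _ _ _ | here x≡y  = inj₁ x≡y
  ... | tri< _ _ _ | there x∈′ = inj₂ x∈′
  ... | tri≈ _ _ _ | x∈′       = inj₂ x∈′
  ... | tri> _ _ _ | here x≡z  = inj₂ (here x≡z)
  ... | tri> _ _ _ | there x∈′ with ∈-insertList⁻ ys x∈′
  ...   | inj₁ x≡y  = inj₁ x≡y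
  ...   | inj₂ x∈ys = inj₂ (there x∈ys)

  ∈-foldr-insert⁺ : ∀ {x} {xs : List U} → x List∈.∈ xs → x ∈ List.foldr insert ∅ xs
  ∈-foldr-insert⁺ (here {xs = xs} refl) = ∈-insertList⁺ (elements (List.foldr insert ∅ xs)) (inj₁ refl)
  ∈-foldr-insert⁺ (there x∈)                = ∈-insertList⁺ _ (inj₂ (∈-foldr-insert⁺ x∈))

  ∈-foldr-insert⁻ : ∀ {x} (xs : List U) → x ∈ List.foldr insert ∅ xs → x List∈.∈ xs
  ∈-foldr-insert⁻ (y ∷ xs) x∈ with ∈-insertList⁻ (elements (List.foldr insert ∅ xs)) x∈
  ... | inj₁ x≡y = here x≡y
  ... | inj₂ x∈′ = there (∈-foldr-insert⁻ xs x∈′)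

  -- The field `increasing` is irrelevant, so a usable proof is recomputed by deciding sortedness.
  sorted : ∀ S → AllPairs _<_ (elements S)
  sorted (mkSubset xs xs↗) = recompute (AllPairs.allPairs? _<?_ xs) xs↗

  -- `enumeration` follows `Fin n` and need not be increasing; repeated insertion sorts it.
  universe : Subset
  universe = List.foldr insert ∅ enumeration

  restrict : ∀ {p} {P : Pred U p} → Decidable P → Subset
  restrict P? = mkSubset (filter P? (elements universe)) (AllPairs.filter⁺ P? (sorted universe))

  module _ {p} {P : Pred U p} (P? : Decidable P) where

    ∈-restrict⁺ : ∀ {x} → P x → x ∈ restrict P?
    ∈-restrict⁺ {x} px = List∈.∈-filter⁺ P? (∈-foldr-insert⁺ (∈-enumeration x)) px

    ∈-restrict⁻ : ∀ {x} → x ∈ restrict P? → P x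
    ∈-restrict⁻ x∈ = proj₂ (List∈.∈-filter⁻ P? {xs = elements universe} x∈)

  ≢∅⇒∃∈ : ∀ {S} → S ≢ ∅ → ∃ (_∈ S)
  ≢∅⇒∃∈ {mkSubset []      _} S≢∅ = contradiction refl S≢∅
  ≢∅⇒∃∈ {mkSubset (x ∷ _) _} _   = x , here refl

  ∈⇒≢∅ : ∀ {x S} → x ∈ S → S ≢ ∅
  ∈⇒≢∅ () refl

  min-exists : ∀ {x S} → x ∈ S → ∃ λ y → min S ≡ just y
  min-exists {S = mkSubset (y ∷ _) _} _ = y , refl

  min-∈ : ∀ {y} S → min S ≡ just y → y ∈ S
  min-∈ (mkSubset (_ ∷ _) _) refl = here refl

  min-least : ∀ {x y} S → min S ≡ just y → x ∈ S → ¬ x < y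
  min-least S@(mkSubset (_ ∷ _) _) refl (here refl) x<y = irrefl refl x<y
  min-least S@(mkSubset (_ ∷ _) _) refl (there x∈)  x<y =
    asym x<y (All.lookup (AllPairs.head (sorted S)) x∈)

  -- Expansion into singleton rows.

  module _ (p : Placement m) (surj : ColSurjective p) where

    open Lex p
    open Rank ≺-isStrictTotalOrder proj₂

    -- Rows are expanded in decreasing order, so the last one holds the minimum.
    lastInRow : ∀ j → ∃ λ w → row p w ≡ j × (∀ x → row p x ≡ j → ¬ x < w)
    lastInRow j =
      let x , rx≡j = row-surjective p j
          w , eq   = min-exists {S = restrict inRow?} (∈-restrict⁺ inRow? rx≡j)
      in w , ∈-restrict⁻ inRow? (min-∈ (restrict inRow?) eq) ,
         λ y ry≡j → min-least (restrict inRow?) eq (∈-restrict⁺ inRow? ry≡j)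
      where
      inRow? : Decidable (λ x → row p x ≡ j)
      inRow? x = row p x Fin.≟ j

    last : Fin m → U
    last j = proj₁ (lastInRow j)

    row-last : ∀ j → row p (last j) ≡ j
    row-last j = proj₁ (proj₂ (lastInRow j))

    -- By minimality `last j` is the `≺`-greatest element on row `j`, so whatever follows it is on a
    -- later row. With the converse `<⇒last-≺`, comparing a column with a row becomes comparing
    -- ranks, which is why `expand` keeps the order.
    last-≺⇒< : ∀ {j x} → last j ≺ x → j Fin.< row p x
    last-≺⇒< {j} (inj₁ j<rx)          = subst (Fin._< _) (row-last j) j<rx
    last-≺⇒< {j} {x} (inj₂ (eq , x<)) =
      contradiction x< (proj₂ (proj₂ (lastInRow j)) x (trans (sym eq) (row-last j)))

    <⇒last-≺ : ∀ {j x} → j Fin.< row p x → last j ≺ x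
    <⇒last-≺ {j} j<rx = inj₁ (subst (Fin._< _) (sym (row-last j)) j<rx)

    expand : Placement n
    expand = record
      { row            = rank
      ; col            = rank ∘ last ∘ col p
      ; row≤col        = λ x → ℕ.≮⇒≥ λ last<x →
          ℕ.<⇒≱ (last-≺⇒< {x = x} (rank-cancel last<x)) (row≤col p x)
      ; row-surjective = rank-surjective
      }

    expand-sameOrder : SameOrder p expand
    expand-sameOrder =
      (λ {x} {y} → rank-mono {last (col p x)} {y} ∘ <⇒last-≺) ,
      (λ {x} {y} → last-≺⇒< {x = y} ∘ rank-cancel {last (col p x)} {y})

    -- For elements of consecutive ranks on the same row of `p`, `≺` is the descent itself.
    -- Otherwise `x` comes last on its row of `p`; some `z` lies in column `row p x`, and expansion
    -- sends it to column `rank x`, which is therefore not empty.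
    expand-rigid : Rigid expand
    expand-rigid .row-injective = rank-injective
    expand-rigid .descent {x} {y} ry≡1+rx empty
      with rank-cancel {x} {y} (ℕ.≤-reflexive (sym ry≡1+rx))
    ... | inj₂ (_ , y<x) = y<x
    ... | inj₁ rx<ry with surj (row p x)
    ...   | z , cz≡rx = contradiction (Fin.toℕ-injective (ℕ.≤-antisym upper lower)) (empty z)
      where
      upper : rank (last (col p z)) Fin.≤ rank x
      upper = ℕ.s≤s⁻¹ (subst (toℕ (rank (last (col p z))) ℕ.<_) ry≡1+rx
        (rank-mono {last (col p z)} {y} (<⇒last-≺ (subst (Fin._< _) (sym cz≡rx) rx<ry))))

      lower : rank x Fin.≤ rank (last (col p z))
      lower = ℕ.≮⇒≥ λ last<x → ℕ.<-irrefl (cong toℕ cz≡rx) (last-≺⇒< {x = x} (rank-cancel last<x))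

  -- From matrices to placements and back.

  subset-ext : ∀ {S T} → (∀ {x} → x ∈ S → x ∈ T) → (∀ {x} → x ∈ T → x ∈ S) → S ≡ T
  subset-ext {S} {T} S⊆T T⊆S = elements-injective (go (sorted S) (sorted T) S⊆T T⊆S)
    where
    elements-injective : ∀ {S T} → elements S ≡ elements T → S ≡ T
    elements-injective refl = refl

    tail⊆ : ∀ {x : U} {xs ys} → All (x <_) xs →
            (∀ {z} → z List∈.∈ (x ∷ xs) → z List∈.∈ (x ∷ ys)) →
            ∀ {z} → z List∈.∈ xs → z List∈.∈ ys
    tail⊆ x<xs ⊆ z∈xs with ⊆ (there z∈xs)
    ... | here refl  = contradiction (All.lookup x<xs z∈xs) (irrefl refl)
    ... | there z∈ys = z∈ys

    heads : ∀ {x y : U} {xs ys} → All (x <_) xs → All (y <_) ys →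
            x List∈.∈ (y ∷ ys) → y List∈.∈ (x ∷ xs) → x ≡ y
    heads _    _    (here x≡y)   _            = x≡y
    heads _    _    (there _)    (here y≡x)   = sym y≡x
    heads x<xs y<ys (there x∈ys) (there y∈xs) =
      contradiction (All.lookup x<xs y∈xs) (asym (All.lookup y<ys x∈ys))

    go : ∀ {xs ys : List U} → AllPairs _<_ xs → AllPairs _<_ ys →
         (∀ {z} → z List∈.∈ xs → z List∈.∈ ys) → (∀ {z} → z List∈.∈ ys → z List∈.∈ xs) → xs ≡ ys
    go []             []             _ _ = refl
    go []             (_ ∷ _)        _ ⊇ with () ← ⊇ (here refl)
    go (_ ∷ _)        []             ⊆ _ with () ← ⊆ (here refl)
    go (x<xs ∷ xs↗) (y<ys ∷ ys↗) ⊆ ⊇ with heads x<xs y<ys (⊆ (here refl)) (⊇ (here refl))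
    ... | refl = cong (_ ∷_) (go xs↗ ys↗ (tail⊆ x<xs ⊆) (tail⊆ y<ys ⊇))

  -- Instantiated below with sets and with ballots as entries.
  module Entries {e} {E : Set e} {r} (_∋_ : E → U → Set r) (o : E) (∌o : ∀ {x} → ¬ o ∋ x) where

    infix 4 _ε_

    _ε_ : U → E → Set r
    x ε S = S ∋ x

    record Locates (p : Placement m) (M : SquareMatrix E m) : Set (a ⊔ r) where
      field
        at     : ∀ x → x ε M ⟨ row p x , col p x ⟩
        unique : ∀ {x i j} → x ε M ⟨ i , j ⟩ → i ≡ row p x × j ≡ col p x

    open Locates public

    -- Non-emptiness of a row is given by an element on it, because for abstract entries `≢ o` does
    -- not yield one.
    locate : (M : SquareMatrix E m) →
             (∀ i j → j Fin.< i → M ⟨ i , j ⟩ ≡ o) →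
             (∀ i j i′ j′ → (i , j) ≢ (i′ , j′) → ∀ x → ¬ (x ε M ⟨ i , j ⟩ × x ε M ⟨ i′ , j′ ⟩)) →
             (∀ x → ∃₂ λ i j → x ε M ⟨ i , j ⟩) →
             (∀ i → ∃₂ λ j x → x ε M ⟨ i , j ⟩) →
             ∃ λ p → Locates p M
    locate {m} M upperTriangular disjoint covers nonEmptyRow = p , located
      where
      unique′ : ∀ {x i j i′ j′} → x ε M ⟨ i , j ⟩ → x ε M ⟨ i′ , j′ ⟩ → i ≡ i′ × j ≡ j′
      unique′ {x} {i} {j} {i′} {j′} x∈ x∈′ with i Fin.≟ i′ | j Fin.≟ j′
      ... | yes i≡i′ | yes j≡j′ = i≡i′ , j≡j′
      ... | yes _    | no  j≢j′ = contradiction (x∈ , x∈′) (disjoint i j i′ j′ (j≢j′ ∘ cong proj₂) x)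
      ... | no  i≢i′ | _        = contradiction (x∈ , x∈′) (disjoint i j i′ j′ (i≢i′ ∘ cong proj₁) x)

      p : Placement m
      p = record
        { row            = λ x → proj₁ (covers x)
        ; col            = λ x → proj₁ (proj₂ (covers x))
        ; row≤col        = λ x → ℕ.≮⇒≥ λ c<r →
            ∌o (subst (x ε_) (upperTriangular _ _ c<r) (proj₂ (proj₂ (covers x))))
        ; row-surjective = λ i →
            let j , x , x∈ = nonEmptyRow i in x , proj₁ (unique′ (proj₂ (proj₂ (covers x))) x∈)
        }

      located : Locates p M
      located .at x       = proj₂ (proj₂ (covers x))
      located .unique x∈  = unique′ x∈ (proj₂ (proj₂ (covers _)))

    module _ {p : Placement m} {M : SquareMatrix E m} (located : Locates p M) where

      located-upperTriangular : ∀ i j → j Fin.< i → ∀ {x} → ¬ x ε M ⟨ i , j ⟩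
      located-upperTriangular i j j<i {x} x∈ with refl , refl ← unique located x∈ =
        ℕ.<⇒≱ j<i (row≤col p x)

      located-disjoint : ∀ i j i′ j′ → (i , j) ≢ (i′ , j′) →
                         ∀ x → ¬ (x ε M ⟨ i , j ⟩ × x ε M ⟨ i′ , j′ ⟩)
      located-disjoint i j i′ j′ ≢ x (x∈ , x∈′)
        with refl , refl ← unique located x∈ | refl , refl ← unique located x∈′ = ≢ refl

      located-covers : ∀ x → ∃₂ λ i j → x ε M ⟨ i , j ⟩
      located-covers x = row p x , col p x , at located x

      located-row : ∀ i → ∃₂ λ j x → x ε M ⟨ i , j ⟩
      located-row i with x , refl ← row-surjective p i = col p x , x , at located x

    located-⊆ : {p q : Placement m} {M N : SquareMatrix E m} → row p ≗ row q → col p ≗ col q →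
                Locates p M → Locates q N → ∀ {x i j} → x ε M ⟨ i , j ⟩ → x ε N ⟨ i , j ⟩
    located-⊆ {N = N} rows cols located located′ {x} x∈ with unique located x∈
    ... | refl , refl = subst₂ (λ i j → x ε N ⟨ i , j ⟩) (sym (rows x)) (sym (cols x)) (at located′ x)

    located-sameOrder : {p : Placement m} {q : Placement m′}
                        {M : SquareMatrix E m} {N : SquareMatrix E m′} →
                        Locates p M → Locates q N → _,_ {B = SquareMatrix E} m M ≡ (m′ , N) →
                        SameOrder p q
    located-sameOrder {p = p} {q} locM locN refl =
      (λ {x} {y} → subst₂ Fin._<_ (cols x) (rows y)) ,
      (λ {x} {y} → subst₂ Fin._<_ (sym (cols x)) (sym (rows y)))
      where
      rows : row p ≗ row q
      rows x = proj₁ (unique locN (at locM x))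

      cols : col p ≗ col q
      cols x = proj₂ (unique locN (at locM x))

    locates-fromCells : (p : Placement m) (f : Fin m → Fin m → E) →
                        (∀ x → x ε f (row p x) (col p x)) →
                        (∀ {x i j} → x ε f i j → i ≡ row p x × j ≡ col p x) →
                        Locates p (fromCells f)
    locates-fromCells p f f-at f-unique .at x =
      subst (x ε_) (sym (lookup-fromCells f _ _)) (f-at x)
    locates-fromCells p f f-at f-unique .unique {x} {i} {j} x∈ =
      f-unique (subst (x ε_) (lookup-fromCells f i j) x∈)

  module Sets    = Entries (flip _∈_)  ∅  (λ ())
  module Ballots = Entries (flip _∈ᵇ_) [] (λ ())

  inCell? : (p : Placement m) (i j : Fin m) → Decidable (λ x → i ≡ row p x × j ≡ col p x)
  inCell? p i j x = i Fin.≟ row p x ×-dec j Fin.≟ col p x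

  cell : Placement m → Fin m → Fin m → Subset
  cell p i j = restrict (inCell? p i j)

  locateᶜ : (C : CompMat) → ∃ λ p → ColSurjective p × Sets.Locates p (CompMat.entries C)
  locateᶜ C = p , surj , located
    where
    open CompMat C
    open IsCompositionMatrix isCompositionMatrix
    pl = Sets.locate entries upperTriangular disjoint covers
           (λ i → let j , ≢∅ = nonEmptyRow i in j , ≢∅⇒∃∈ ≢∅)

    p : Placement size
    p = proj₁ pl

    located : Sets.Locates p entries
    located = proj₂ pl

    surj : ColSurjective p
    surj j =
      let i , ≢∅ = nonEmptyColumn j
          x , x∈ = ≢∅⇒∃∈ ≢∅
      in x , sym (proj₂ (Sets.unique located x∈))

  compositionMatrix : (p : Placement m) → ColSurjective p →
                      ∃ λ (M : SquareMatrix Subset m) → IsCompositionMatrix M × Sets.Locates p M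
  compositionMatrix p surj = fromCells (cell p) , valid , located
    where
    located : Sets.Locates p (fromCells (cell p))
    located = Sets.locates-fromCells p (cell p)
      (λ x → ∈-restrict⁺ (inCell? p _ _) (refl , refl))
      (λ {x} {i} {j} → ∈-restrict⁻ (inCell? p i j))

    ∄∈⇒≡∅ : ∀ {S} → (∀ {x} → ¬ x ∈ S) → S ≡ ∅
    ∄∈⇒≡∅ ∄∈ = subset-ext (λ x∈ → contradiction x∈ ∄∈) (λ ())

    valid : IsCompositionMatrix (fromCells (cell p))
    valid = record
      { upperTriangular = λ i j j<i → ∄∈⇒≡∅ (Sets.located-upperTriangular located i j j<i)
      ; disjoint        = Sets.located-disjoint located
      ; covers          = Sets.located-covers located
      ; nonEmptyRow     = λ i → let j , x , x∈ = Sets.located-row located i in j , ∈⇒≢∅ x∈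
      ; nonEmptyColumn  = λ j → let x , cx≡j = surj j in
          row p x , ∈⇒≢∅ (subst (λ j → x ∈ fromCells (cell p) ⟨ row p x , j ⟩) cx≡j
                                (Sets.at located x))
      }

  ≢[]⇒∃∈ᵇ : ∀ {Bs} → IsBallot Bs → Bs ≢ [] → ∃ (_∈ᵇ Bs)
  ≢[]⇒∃∈ᵇ {[]}     ballot Bs≢[] = contradiction refl Bs≢[]
  ≢[]⇒∃∈ᵇ {B ∷ Bs} ballot _ with B≢∅ ∷ _ ← IsBallot.nonEmpty ballot =
    let x , x∈B = ≢∅⇒∃∈ B≢∅ in x , here x∈B

  ∄∈ᵇ⇒≡[] : ∀ {Bs} → IsBallot Bs → (∀ {x} → ¬ x ∈ᵇ Bs) → Bs ≡ []
  ∄∈ᵇ⇒≡[] {[]}     _      _   = refl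
  ∄∈ᵇ⇒≡[] {B ∷ Bs} ballot ∄∈ᵇ = contradiction (proj₂ (≢[]⇒∃∈ᵇ ballot λ ())) ∄∈ᵇ

  -- A second block would be non-empty, so two blocks would contain `x`, against disjointness.
  singleton-ballot : ∀ {x Bs} → IsBallot Bs → x ∈ᵇ Bs → (∀ {y} → y ∈ᵇ Bs → y ≡ x) → Bs ≡ ⁅ x ⁆ ∷ []
  singleton-ballot {x} {B ∷ []} ballot (here x∈B) only =
    cong (_∷ []) (subset-ext (here ∘ only ∘ here) (λ { (here refl) → x∈B }))
  singleton-ballot {Bs = B ∷ C ∷ Bs} ballot _ only
    with B≢∅ ∷ C≢∅ ∷ _ ← IsBallot.nonEmpty ballot | (disjoint ∷ _) ∷ _ ← IsBallot.disjoint ballot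
    with ≢∅⇒∃∈ B≢∅ | ≢∅⇒∃∈ C≢∅
  ... | y , y∈B | z , z∈C with refl ← only (here y∈B) | refl ← only (there (here z∈C)) =
    contradiction (y∈B , z∈C) (disjoint y)

  -- A block must not be empty, so `∅` has to become the empty ballot. On an expanded placement each
  -- cell has at most one element, and this is the only ballot on it.
  block : Subset → Blocks
  block (mkSubset []       _)  = []
  block (mkSubset (x ∷ xs) ↗) = mkSubset (x ∷ xs) ↗ ∷ []

  block-isBallot : ∀ S → IsBallot (block S)
  block-isBallot (mkSubset []      _) = record { nonEmpty = [] ; disjoint = [] }
  block-isBallot (mkSubset (_ ∷ _) _) = record { nonEmpty = (λ ()) ∷ [] ; disjoint = [] ∷ [] }

  ∈-block⁺ : ∀ {x} S → x ∈ S → x ∈ᵇ block S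
  ∈-block⁺ (mkSubset (_ ∷ _) _) x∈S = here x∈S

  ∈-block⁻ : ∀ {x} S → x ∈ᵇ block S → x ∈ S
  ∈-block⁻ (mkSubset (_ ∷ _) _) (here x∈S) = x∈S

  locateᵇ : (A : BalMat) → ∃ λ p → Ballots.Locates p (BalMat.entries A)
  locateᵇ A = Ballots.locate entries upperTriangular disjoint covers
    (λ i → let j , ≢[] = nonEmptyRow i in j , ≢[]⇒∃∈ᵇ (ballots i j) ≢[])
    where
    open BalMat A
    open IsBallotMatrix isBallotMatrix

  ballotMatrix : (p : Placement m) → ∃ λ (M : SquareMatrix Blocks m) →
                 IsBallotMatrix M × Ballots.Locates p M
  ballotMatrix p = M , valid , located
    where
    M = fromCells (λ i j → block (cell p i j))

    located : Ballots.Locates p M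
    located = Ballots.locates-fromCells p _
      (λ x → ∈-block⁺ _ (∈-restrict⁺ (inCell? p _ _) (refl , refl)))
      (λ {x} {i} {j} x∈ → ∈-restrict⁻ (inCell? p i j) (∈-block⁻ _ x∈))

    ballots : ∀ i j → IsBallot (M ⟨ i , j ⟩)
    ballots i j = subst IsBallot (sym (lookup-fromCells _ i j)) (block-isBallot (cell p i j))

    valid : IsBallotMatrix M
    valid = record
      { upperTriangular = λ i j j<i →
          ∄∈ᵇ⇒≡[] (ballots i j) (Ballots.located-upperTriangular located i j j<i)
      ; ballots         = ballots
      ; disjoint        = Ballots.located-disjoint located
      ; covers          = Ballots.located-covers located
      ; nonEmptyRow     = λ i → let j , x , x∈ = Ballots.located-row located i in
          j , λ ≡[] → case subst (x ∈ᵇ_) ≡[] x∈ of λ ()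
      }

  P-located : (A : BalMat) {p : Placement (BalMat.size A)} → Ballots.Locates p (BalMat.entries A) →
              (∀ {x y} → P A x y → col p x Fin.< row p y) ×
              (∀ {x y} → col p x Fin.< row p y → P A x y)
  P-located A {p} located =
    (λ (i , j , i′ , j′ , x∈ , y∈ , j<i′) →
      subst₂ Fin._<_ (proj₂ (Ballots.unique located x∈)) (proj₁ (Ballots.unique located y∈)) j<i′) ,
    (λ {x} {y} c<r → row p x , col p x , row p y , col p y ,
      Ballots.at located x , Ballots.at located y , c<r)

  -- Fixed points of `η` and rigid placements.

  ∈-⋃⁺ : ∀ {x Ss} → Any (x ∈_) Ss → x ∈ ⋃ Ss
  ∈-⋃⁺ = ∈-foldr-insert⁺ ∘ Any.concatMap⁺ elements

  ∈-⋃⁻ : ∀ {x} Ss → x ∈ ⋃ Ss → Any (x ∈_) Ss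
  ∈-⋃⁻ Ss = Any.concatMap⁻ elements ∘ ∈-foldr-insert⁻ (List.concatMap elements Ss)

  ∈-rowSet⁺ : ∀ {x} (M : SquareMatrix Blocks m) i j → x ∈ᵇ M ⟨ i , j ⟩ → x ∈ rowSet M i
  ∈-rowSet⁺ M i j x∈ = ∈-⋃⁺ (Any.concat⁺ (VecAny.toList⁺ (any-lookup (lookup M i) j x∈)))

  ∈-rowSet⁻ : ∀ {x} (M : SquareMatrix Blocks m) i → x ∈ rowSet M i → ∃ λ j → x ∈ᵇ M ⟨ i , j ⟩
  ∈-rowSet⁻ M i x∈ = _ , VecAny.lookup-index
    (VecAny.toList⁻ (Any.concat⁻ (toList (lookup M i)) (∈-⋃⁻ (List.concat (toList (lookup M i))) x∈)))

  ∈-underlyingSet : ∀ {x} (M : SquareMatrix Blocks m) i j → x ∈ᵇ M ⟨ i , j ⟩ → x ∈ underlyingSet M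
  ∈-underlyingSet M i j x∈ = ∈-⋃⁺ (Any.concat⁺ (VecAny.toList⁺
    (VecAny.concat⁺ (any-lookup M i (any-lookup (lookup M i) j x∈)))))

  firstPivot-nothing⁻ : (M : SquareMatrix Blocks m) → ∀ xs → firstPivot M xs ≡ nothing →
                        ∀ {x} → x List∈.∈ xs → ¬ Pivot M x
  firstPivot-nothing⁻ M (y ∷ xs) eq x∈ with pivot? M y
  firstPivot-nothing⁻ M (y ∷ xs) eq (here refl) | no ¬piv = ¬piv
  firstPivot-nothing⁻ M (y ∷ xs) eq (there x∈)  | no ¬piv = firstPivot-nothing⁻ M xs eq x∈

  firstPivot-nothing⁺ : (M : SquareMatrix Blocks m) → (∀ x → ¬ Pivot M x) →
                        ∀ xs → firstPivot M xs ≡ nothing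
  firstPivot-nothing⁺ M ∄pivot []       = refl
  firstPivot-nothing⁺ M ∄pivot (x ∷ xs) with pivot? M x
  ... | yes piv = contradiction piv (∄pivot x)
  ... | no  _   = firstPivot-nothing⁺ M ∄pivot xs

  -- `moveA` adds a row and `moveB` removes one, so acting on a pivot always changes the size.
  φ-fixed⁻ : (M : SquareMatrix Blocks m) → φ M ≡ (m , M) →
             firstPivot M (elements (underlyingSet M)) ≡ nothing
  φ-fixed⁻ {m}     M eq with firstPivot M (elements (underlyingSet M))
  φ-fixed⁻ {m}     M eq | nothing                  = refl
  φ-fixed⁻ {m}     M eq | just (x , inj₁ _)        = contradiction (cong proj₁ eq) ℕ.1+n≢n
  φ-fixed⁻ {zero}  M eq | just (x , inj₂ (() , _))
  φ-fixed⁻ {suc m} M eq | just (x , inj₂ _)        = contradiction (sym (cong proj₁ eq)) ℕ.1+n≢n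

  φ-fixed⁺ : (M : SquareMatrix Blocks m) →
             firstPivot M (elements (underlyingSet M)) ≡ nothing → φ M ≡ (m , M)
  φ-fixed⁺ M eq with firstPivot M (elements (underlyingSet M)) | eq
  ... | nothing | refl = refl

  -- `ψ` keeps the size, so in its branch equality of the pairs gives `ψ M ≡ M`, by uniqueness of
  -- identity proofs on `ℕ`.
  η-fixed⁻ : (M : SquareMatrix Blocks m) → η (m , M) ≡ (m , M) → φ M ≡ (m , M)
  η-fixed⁻ M eq with Vec.≡-dec (Vec.≡-dec _≟ᵇ_) (ψ M) M
  ... | yes _    = eq
  ... | no  ψM≢M = contradiction (,-injectiveʳ-UIP ℕ.≡-irrelevant eq) ψM≢M

  η-fixed⁺ : (M : SquareMatrix Blocks m) → ψ M ≡ M → φ M ≡ (m , M) → η (m , M) ≡ (m , M)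
  η-fixed⁺ M ψM≡M φM≡M with Vec.≡-dec (Vec.≡-dec _≟ᵇ_) (ψ M) M
  ... | yes _    = φM≡M
  ... | no  ψM≢M = contradiction ψM≡M ψM≢M

  -- Names the function local to the definition of ψ.
  ψ-step : (M : SquareMatrix Blocks m) →
           ∃ λ move → ψ M ≡ fromMaybe M (updateFirst (updateFirst move) M)
  ψ-step M = _ , refl

  ψ-step-nothing : (M : SquareMatrix Blocks m) → ∀ Bs → ballotInvolution Bs ≡ Bs →
                   proj₁ (ψ-step M) Bs ≡ nothing
  ψ-step-nothing M Bs eq with ballotInvolution Bs ≟ᵇ Bs
  ... | yes _ = refl
  ... | no ≢  = contradiction eq ≢

  ψ-fixed⁺ : (M : SquareMatrix Blocks m) →
             (∀ i j → ballotInvolution (M ⟨ i , j ⟩) ≡ M ⟨ i , j ⟩) → ψ M ≡ M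
  ψ-fixed⁺ M fixed = trans (proj₂ (ψ-step M)) (cong (fromMaybe M)
    (updateFirst-nothing (updateFirst (proj₁ (ψ-step M))) M λ i →
      updateFirst-nothing (proj₁ (ψ-step M)) (lookup M i) λ j →
        ψ-step-nothing M (M ⟨ i , j ⟩) (fixed i j)))

  ballotInvolution-singleton : ∀ x → ballotInvolution (⁅ x ⁆ ∷ []) ≡ ⁅ x ⁆ ∷ []
  ballotInvolution-singleton x with ⁅ x ⁆ ≟ˢ ⁅ x ⁆
  ... | yes _ = refl
  ... | no ≢  = contradiction refl ≢

  two-elements : ∀ {x y} S → x ∈ S → y ∈ S → x ≢ y → 2 ℕ.≤ ∣ S ∣
  two-elements (mkSubset (_ ∷ [])    _) (here refl) (here refl) x≢y = contradiction refl x≢y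
  two-elements (mkSubset (_ ∷ _ ∷ _) _) _           _           _   = s≤s (s≤s z≤n)

  subsingleton : ∀ S → (∀ {x y} → x ∈ S → y ∈ S → x ≡ y) → ¬ 2 ℕ.≤ ∣ S ∣
  subsingleton S@(mkSubset (_ ∷ _ ∷ _) _) equal _ =
    irrefl (equal (here refl) (there (here refl))) (All.head (AllPairs.head (sorted S)))
  subsingleton (mkSubset (_ ∷ []) _) _ (s≤s ())

  module _ {M : SquareMatrix Blocks m} (valid : IsBallotMatrix M)
           {p : Placement m} (located : Ballots.Locates p M) where

    open IsBallotMatrix valid using (ballots)

    rowSet-row : ∀ {x i} → x ∈ rowSet M i → row p x ≡ i
    rowSet-row {i = i} x∈ with j , x∈ᵇ ← ∈-rowSet⁻ M i x∈ = sym (proj₁ (Ballots.unique located x∈ᵇ))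

    row-rowSet : ∀ x → x ∈ rowSet M (row p x)
    row-rowSet x = ∈-rowSet⁺ M _ _ (Ballots.at located x)

    module _ (row-inj : ∀ {x y} → row p x ≡ row p y → x ≡ y) where

      own-entry : ∀ x → M ⟨ row p x , col p x ⟩ ≡ ⁅ x ⁆ ∷ []
      own-entry x = singleton-ballot (ballots _ _) (Ballots.at located x)
        (λ y∈ → row-inj (sym (proj₁ (Ballots.unique located y∈))))

      other-entry : ∀ x j → j ≢ col p x → M ⟨ row p x , j ⟩ ≡ []
      other-entry x j j≢ = ∄∈ᵇ⇒≡[] (ballots _ _) λ {y} y∈ →
        let rx≡ry , j≡cy = Ballots.unique located y∈
        in j≢ (trans j≡cy (cong (col p) (sym (row-inj rx≡ry))))

    -- The minimum of a row with two elements would be a pivot of type (a). Once rows are known to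
    -- be singletons, `y` is the minimum of its row, and `x < y` over an empty column would make `x`
    -- a pivot of type (b).
    fixed⇒rigid : η (m , M) ≡ (m , M) → Rigid p
    fixed⇒rigid fixed = record { row-injective = row-inj ; descent = desc }
      where
      ∄pivot : ∀ x → ¬ Pivot M x
      ∄pivot x = firstPivot-nothing⁻ M (elements (underlyingSet M)) (φ-fixed⁻ M (η-fixed⁻ M fixed))
        (∈-underlyingSet M _ _ (Ballots.at located x))

      row-inj : ∀ {x y} → row p x ≡ row p y → x ≡ y
      row-inj {x} {y} rx≡ry with x ≟ y
      ... | yes x≡y = x≡y
      ... | no  x≢y =
        let z , eq  = min-exists {S = rowSet M (row p x)} (row-rowSet x)
            j , z∈ᵇ = ∈-rowSet⁻ M (row p x) (min-∈ (rowSet M (row p x)) eq)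
        in contradiction
          (inj₁ (row p x , j , z∈ᵇ ,
                 two-elements (rowSet M (row p x)) (row-rowSet x)
                   (subst (λ i → y ∈ rowSet M i) (sym rx≡ry) (row-rowSet y)) x≢y ,
                 eq))
          (∄pivot z)

      desc : ∀ {x y} → toℕ (row p y) ≡ suc (toℕ (row p x)) → (∀ z → col p z ≢ row p x) → y < x
      desc {x} {y} ry≡1+rx empty with compare x y
      ... | tri> _ _ y<x = y<x
      ... | tri≈ _ refl _ = contradiction (sym ry≡1+rx) ℕ.1+n≢n
      ... | tri< x<y _ _ = contradiction
        (inj₂ (row p x , col p x , row p y , ry≡1+rx ,
               (λ i → ∄∈ᵇ⇒≡[] (ballots _ _) λ {z} z∈ →
                 empty z (sym (proj₂ (Ballots.unique located z∈)))) ,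
               own-entry row-inj x , other-entry row-inj x ,
               subst (MaybeAny.Any (x <_)) (sym eq) (MaybeAny.just (subst (x <_) (sym z≡y) x<y))))
        (∄pivot x)
        where
        min-row = min-exists {S = rowSet M (row p y)} (row-rowSet y)
        z = proj₁ min-row
        eq = proj₂ min-row

        z≡y : z ≡ y
        z≡y = row-inj (rowSet-row (min-∈ (rowSet M (row p y)) eq))

    -- Every entry is empty or a single singleton block, which the ballot involution fixes. A pivot
    -- of type (a) needs two elements on a row, and one of type (b) an ascent where `descent`
    -- demands the opposite.
    rigid⇒fixed : Rigid p → η (m , M) ≡ (m , M)
    rigid⇒fixed rigid = η-fixed⁺ M (ψ-fixed⁺ M involution-fixed)
      (φ-fixed⁺ M (firstPivot-nothing⁺ M ∄pivot (elements (underlyingSet M))))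
      where
      involution-fixed : ∀ i j → ballotInvolution (M ⟨ i , j ⟩) ≡ M ⟨ i , j ⟩
      involution-fixed i j with row-surjective p i
      ... | x , refl with j Fin.≟ col p x
      ...   | yes refl rewrite own-entry (row-injective rigid) x = ballotInvolution-singleton x
      ...   | no j≢ rewrite other-entry (row-injective rigid) x j j≢ = refl

      ∄pivot : ∀ x → ¬ Pivot M x
      ∄pivot x (inj₁ (i , j , x∈ , 2≤ , _)) = subsingleton (rowSet M i)
        (λ y∈ z∈ → row-injective rigid (trans (rowSet-row y∈) (sym (rowSet-row z∈)))) 2≤
      ∄pivot x (inj₂ (i , j , i⁺ , i⁺≡1+i , empty , entry , _ , x<min))
        with min (rowSet M i⁺) in eq | x<min
      ... | just y | MaybeAny.just x<y = asym x<y (descent rigid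
        (trans (cong toℕ ry≡i⁺) (trans i⁺≡1+i (cong (suc ∘ toℕ) i≡rx)))
        (λ z cz≡rx → ∈ᵇ⇒≢[] (Ballots.at located z)
          (trans (cong (λ j → M ⟨ row p z , j ⟩) (trans cz≡rx (sym i≡rx))) (empty (row p z)))))
        where
        ry≡i⁺ : row p y ≡ i⁺
        ry≡i⁺ = rowSet-row (min-∈ (rowSet M i⁺) eq)

        i≡rx : i ≡ row p x
        i≡rx = proj₁ (Ballots.unique located (subst (x ∈ᵇ_) (sym entry) (here (here refl))))

        ∈ᵇ⇒≢[] : ∀ {z Bs} → z ∈ᵇ Bs → Bs ≢ []
        ∈ᵇ⇒≢[] () refl

  -- The bijection and the class representatives.

  ballotMatrix-≡ : {M : SquareMatrix Blocks m} {N : SquareMatrix Blocks m′}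
    {p : Placement m} {q : Placement m′} → IsBallotMatrix M → IsBallotMatrix N →
    Ballots.Locates p M → Ballots.Locates q N → Rigid p → Rigid q → Agree p q →
    _,_ {B = SquareMatrix Blocks} m M ≡ (m′ , N)
  ballotMatrix-≡ {m} {M = M} {N} {p} {q} validM validN locM locN rigidp rigidq (refl , rows , cols) =
    cong (m ,_) (matrix-ext M N entry≡)
    where
    entry≡ : ∀ i j → M ⟨ i , j ⟩ ≡ N ⟨ i , j ⟩
    entry≡ i j with row-surjective p i
    ... | x , refl with j Fin.≟ col p x
    -- Rigidity leaves one element on the row, so its entry admits a single ballot and the placement
    -- alone determines the matrix.
    ...   | yes refl = trans (own-entry validM locM (row-injective rigidp) x)
      (sym (trans (cong₂ (λ i j → N ⟨ i , j ⟩)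
                         (Fin.toℕ-injective (rows x)) (Fin.toℕ-injective (cols x)))
        (own-entry validN locN (row-injective rigidq) x)))
    ...   | no j≢ = trans (other-entry validM locM (row-injective rigidp) x j j≢)
      (sym (trans (cong (λ i → N ⟨ i , j ⟩) (Fin.toℕ-injective (rows x)))
        (other-entry validN locN (row-injective rigidq) x j
          (λ j≡ → j≢ (trans j≡ (sym (Fin.toℕ-injective (cols x))))))))

  compositionMatrix-≡ : {M : SquareMatrix Subset m} {N : SquareMatrix Subset m′}
    {p : Placement m} {q : Placement m′} → Sets.Locates p M → Sets.Locates q N → Agree p q →
    _,_ {B = SquareMatrix Subset} m M ≡ (m′ , N)
  compositionMatrix-≡ {m} {M = M} {N} {p} {q} locM locN (refl , rows , cols) = cong (m ,_)
    (matrix-ext M N λ i j → subset-ext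
      (Sets.located-⊆ (Fin.toℕ-injective ∘ rows) (Fin.toℕ-injective ∘ cols) locM locN)
      (Sets.located-⊆ (Fin.toℕ-injective ∘ sym ∘ rows) (Fin.toℕ-injective ∘ sym ∘ cols) locN locM))

  fixed-unique : (A B : BalMat) {p : Placement (BalMat.size A)} {q : Placement (BalMat.size B)} →
                 Ballots.Locates p (BalMat.entries A) → Ballots.Locates q (BalMat.entries B) →
                 Fixed A → Fixed B → SameOrder p q → A ≈ᴹ B
  fixed-unique A B {p} {q} locA locB fixA fixB same =
    ballotMatrix-≡ (BalMat.isBallotMatrix A) (BalMat.isBallotMatrix B) locA locB rigidp rigidq
      (rigid-unique p q rigidp rigidq same)
    where
    rigidp = fixed⇒rigid (BalMat.isBallotMatrix A) locA fixA
    rigidq = fixed⇒rigid (BalMat.isBallotMatrix B) locB fixB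

  fixedBallotMatrix : (p : Placement m) → ColSurjective p →
    ∃ λ (A : BalMat) → Fixed A × ∃ λ (q : Placement (BalMat.size A)) →
    Ballots.Locates q (BalMat.entries A) × SameOrder p q
  fixedBallotMatrix p surj =
    let M , valid , located = ballotMatrix (expand p surj) in
    record { isBallotMatrix = valid } ,
    rigid⇒fixed valid located (expand-rigid p surj) ,
    expand p surj , located , expand-sameOrder p surj

  module Image (C : CompMat) where

    private
      locationᶜ = locateᶜ C

    place : Placement (CompMat.size C)
    place = proj₁ locationᶜ

    place-surjective : ColSurjective place
    place-surjective = proj₁ (proj₂ locationᶜ)

    place-located : Sets.Locates place (CompMat.entries C)
    place-located = proj₂ (proj₂ locationᶜ)

    private
      fixedᶜ = fixedBallotMatrix place place-surjective

    image : BalMat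
    image = proj₁ fixedᶜ

    image-fixed : Fixed image
    image-fixed = proj₁ (proj₂ fixedᶜ)

    image-place : Placement (BalMat.size image)
    image-place = proj₁ (proj₂ (proj₂ fixedᶜ))

    image-located : Ballots.Locates image-place (BalMat.entries image)
    image-located = proj₁ (proj₂ (proj₂ (proj₂ fixedᶜ)))

    image-sameOrder : SameOrder place image-place
    image-sameOrder = proj₂ (proj₂ (proj₂ (proj₂ fixedᶜ)))

  open Image

  bijection : Bijection CompMat-setoid FixedBalMat-setoid
  bijection = record
    { to        = λ C → image C , image-fixed C
    ; cong      = λ {C} {D} → image-cong C D
    ; bijective = (λ {C} {D} → image-injective C D) , λ (B , fixed) → image-surjective B fixed
    }
    where
    -- Placements are computed from the validity proofs, which the setoid ignores. Equal matrices
    -- are therefore compared through their orders.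
    image-cong : ∀ C D → CompMat.matrix C ≡ CompMat.matrix D → image C ≈ᴹ image D
    image-cong C D C≡D =
      let c⊑d , d⊑c = Sets.located-sameOrder (place-located C) (place-located D) C≡D
          c⊑i , i⊑c = image-sameOrder C
          d⊑j , j⊑d = image-sameOrder D
      in fixed-unique (image C) (image D) (image-located C) (image-located D)
           (image-fixed C) (image-fixed D) (d⊑j ∘ c⊑d ∘ i⊑c , c⊑i ∘ d⊑c ∘ j⊑d)

    -- Both placements are column-surjective and carry the order of the common image, so
    -- `colSurjective-unique` identifies them.
    image-injective : ∀ C D → image C ≈ᴹ image D → CompMat.matrix C ≡ CompMat.matrix D
    image-injective C D i≡j =
      let i⊑j , j⊑i = Ballots.located-sameOrder (image-located C) (image-located D) i≡j
          c⊑i , i⊑c = image-sameOrder C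
          d⊑j , j⊑d = image-sameOrder D
      in compositionMatrix-≡ (place-located C) (place-located D)
           (colSurjective-unique (place C) (place D) (place-surjective C) (place-surjective D)
             (j⊑d ∘ i⊑j ∘ c⊑i , i⊑c ∘ j⊑i ∘ d⊑j))

    -- The preimage is built from the compression of the placement of `B`; its image is fixed and
    -- has the order of `B`, hence equals `B`.
    image-surjective : ∀ B → Fixed B →
                       ∃ λ C → ∀ {D} → CompMat.matrix D ≡ CompMat.matrix C → image D ≈ᴹ B
    image-surjective B fixed =
      let p , B-located = locateᵇ B
          k , c , surj , p⊑c , c⊑p = compress p
          M , valid , C-located = compositionMatrix c surj
      in record { isCompositionMatrix = valid } , λ {D} D≡C →
        let d⊑c , c⊑d = Sets.located-sameOrder (place-located D) C-located D≡C
            d⊑i , i⊑d = image-sameOrder D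
        in fixed-unique (image D) B (image-located D) B-located (image-fixed D) fixed
             (c⊑p ∘ d⊑c ∘ i⊑d , d⊑i ∘ c⊑d ∘ p⊑c)

  -- Compressing the placement of `A` and expanding the result keeps the order and yields a fixed
  -- matrix; `fixed-unique` excludes any other.
  representative : (A : BalMat) → ∃! _≈ᴹ_ (λ B → Equivalent A B × Fixed B)
  representative A =
    let p , A-located = locateᵇ A
        k , c , surj , p⊑c , c⊑p = compress p
        B , B-fixed , q , B-located , c⊑q , q⊑c = fixedBallotMatrix c surj
        A⇒p , p⇒A = P-located A A-located
        B⇒q , q⇒B = P-located B B-located
    in B ,
       ((q⇒B ∘ c⊑q ∘ p⊑c ∘ A⇒p , p⇒A ∘ c⊑p ∘ q⊑c ∘ B⇒q) , B-fixed) ,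
       λ {C} ((A⇒C , C⇒A) , C-fixed) →
         let r , C-located = locateᵇ C
             C⇒r , r⇒C     = P-located C C-located
         in fixed-unique B C B-located C-located B-fixed C-fixed
              (C⇒r ∘ A⇒C ∘ p⇒A ∘ c⊑p ∘ q⊑c , c⊑q ∘ p⊑c ∘ A⇒p ∘ C⇒A ∘ r⇒C)

proposition3 : ∀ {a ℓ : Level} {U : Set a} {_<_ : Rel U ℓ} {n : ℕ} → Fin n ↔ U →
    (isStrictTotalOrder : IsStrictTotalOrder _≡_ _<_) →
    let open BallotMatrices isStrictTotalOrder in
    Bijection CompMat-setoid FixedBalMat-setoid ×
    (∀ (A : BalMat) → ∃! _≈ᴹ_ (λ B → Equivalent A B × Fixed B))
proposition3 finite isStrictTotalOrder = bijection , representative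
  where open Proof finite isStrictTotalOrder
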